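{- Let $a,b,c,d,f,g,h,\ell,p,r,s,t,u,w\in\mathbb R$ and let $m_n$ be the coefficient of $z^n$ in $\mathcal C(z)$ ($n\ge0$; so $m_0=1$). Then for every $n$, $$\det(m_{i+j})_{0\le i,j\le n}=(pr)^{\binom{n+1}{2}}\prod_{i=1}^n [i]_{c,d}!\,[i]_{h,\ell}!,$$ where $[i]_{x,y}!:=[i]_{x,y}[i-1]_{x,y}\cdots[1]_{x,y}$.
   Context: For $n\ge1$, $[n]_{x,y}:=\sum_{i=0}^{n-1}x^{n-1-i}y^{i}$, and $[0]_{x,y}:=0$, with the convention $0^0=1$. For real parameters $a,b,c,d,f,g,h,\ell,p,r,s,t,u,w$, $\mathcal C(z)$ is the formal power series in $z$ defined by the continued fraction $$\mathcal C(z)=\cfrac{1}{1-\alpha_0z-\cfrac{\beta_1z^2}{1-\alpha_1z-\cfrac{\beta_2z^2}{\ddots}}},\qquad \alpha_n=u\,w^n+s\,[n]_{a,b}+t\,[n]_{f,g}\ (n\ge 0),\quad \beta_n=p\,r\,[n]_{c,d}\,[n]_{h,\ell}\ (n\ge 1).$$ -}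

module Defs where

open import Algebra.Bundles using (CommutativeRing)
open import Data.Fin.Base using (Fin; zero; suc; toℕ; punchIn)
open import Data.Fin.Properties using (toℕ≤pred[n])
open import Data.Nat.Base as ℕ using (ℕ; zero; suc; _∸_; _≤_; _<_; z≤n; s≤s; s≤s⁻¹)
import Data.Nat.Properties as ℕ
open import Data.Vec.Functional using (Vector; []; _∷_)
open import Function.Base using (_∘_)
open import Relation.Binary.PropositionalEquality.Core as ≡ using (_≡_)

module JFractions {κ κ′} (R : CommutativeRing κ κ′) where

  open CommutativeRing R hiding (zero)
  open import Algebra.Properties.Semiring.Exp semiring public using (_^_)
  open import Algebra.Properties.Semiring.Sum semiring public
    using (sum; sum-syntax)
  open import Algebra.Properties.Semiring.Sum semiring using (sum-cong-≋)
  open import Algebra.Properties.CommutativeMonoid.Sum *-commutativeMonoid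
    using () renaming (sum to product)
  open import Relation.Binary.Reasoning.Setoid setoid

  infixl 10 product-syntax

  product-syntax : ∀ n → (Fin n → Carrier) → Carrier
  product-syntax n f = product {n} f

  syntax product-syntax n (λ i → x) = ∏[ i < n ] x

  Matrix : ℕ → Set κ
  Matrix n = Fin n → Fin n → Carrier

  -- Cofactor expansion along the first row.
  det : ∀ {n} → Matrix n → Carrier
  det {zero}  M = 1#
  det {suc n} M =
    ∑[ j < suc n ] ((- 1#) ^ toℕ j * M zero j * det (λ i k → M (suc i) (punchIn j k)))

  -- The empty sum gives [0]_{x,y} = 0, and x ^ 0 = 1# for every x.
  [_]⟨_,_⟩ : ℕ → Carrier → Carrier → Carrier
  [ n ]⟨ x , y ⟩ = ∑[ i < n ] (x ^ (n ∸ 1 ∸ toℕ i) * y ^ toℕ i)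

  [_]⟨_,_⟩! : ℕ → Carrier → Carrier → Carrier
  [ zero  ]⟨ x , y ⟩! = 1#
  [ suc n ]⟨ x , y ⟩! = [ suc n ]⟨ x , y ⟩ * [ n ]⟨ x , y ⟩!

  -- A formal power series is its sequence of coefficients.
  Series : Set κ
  Series = ℕ → Carrier

  infix 4 _≈ₛ_
  _≈ₛ_ : Series → Series → Set κ′
  F ≈ₛ G = ∀ n → F n ≈ G n

  0ₛ 1ₛ : Series
  0ₛ _       = 0#
  1ₛ zero    = 1#
  1ₛ (suc _) = 0#

  infixl 7 _*ₛ_
  _*ₛ_ : Series → Series → Series
  (F *ₛ G) n = ∑[ i < suc n ] (F (toℕ i) * G (n ∸ toℕ i))

  -- 1/F for a series F with constant term 1, from the recursion
  -- G₀ = 1, Gₙ₊₁ = - ∑_{i ≤ n} Fᵢ₊₁ Gₙ₋ᵢ.  The vector  recips F n  is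
  -- Gₙ , Gₙ₋₁ , … , G₀.
  recips : Series → ∀ n → Vector Carrier (suc n)
  recips F zero    = 1# ∷ []
  recips F (suc n) = (- ∑[ i < suc n ] (F (suc (toℕ i)) * recips F n i)) ∷ recips F n

  recip : Series → Series
  recip F n = recips F n zero

  -- The series 1 - a z - b z² G(z).
  1-_z-_z²_ : Carrier → Carrier → Series → Series
  (1- a z- b z² G) zero          = 1#
  (1- a z- b z² G) (suc zero)    = - a
  (1- a z- b z² G) (suc (suc n)) = - (b * G n)

  -- convergent N α β is the finite continued fraction with partial denominators
  -- 1 - αₖ z (k = 0 … N - 1) and partial numerators - βₖ z² (k = 1 … N - 1);
  -- β 0 is not used.
  convergent : ℕ → (α β : ℕ → Carrier) → Series
  convergent zero    α β = 0ₛ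
  convergent (suc N) α β =
    recip (1- α 0 z- β 1 z² convergent N (α ∘ suc) (β ∘ suc))

  -- The infinite continued fraction is the z-adic limit of its convergents:
  -- by convergent-stable, the coefficient of zⁿ is the same in all
  -- convergents from the (n + 1)-st on.
  jFraction : (α β : ℕ → Carrier) → Series
  jFraction α β n = convergent (suc n) α β n

  recips-recip : ∀ F n i → recips F n i ≡ recip F (n ∸ toℕ i)
  recips-recip F zero    zero    = ≡.refl
  recips-recip F (suc n) zero    = ≡.refl
  recips-recip F (suc n) (suc i) = recips-recip F n i

  recip-inverse : ∀ F → F 0 ≈ 1# → F *ₛ recip F ≈ₛ 1ₛ
  recip-inverse F F₀≈1 zero = trans (+-identityʳ _) (trans (*-identityʳ _) F₀≈1)
  recip-inverse F F₀≈1 (suc n) = begin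
    F 0 * - S + ∑[ i < suc n ] (F (suc (toℕ i)) * recip F (n ∸ toℕ i))
      ≈⟨ +-cong (trans (*-congʳ F₀≈1) (*-identityˡ _))
                (sum-cong-≋ λ i → *-congˡ {x = F (suc (toℕ i))}
                  (reflexive (≡.sym (recips-recip F n i)))) ⟩
    - S + S
      ≈⟨ -‿inverseˡ S ⟩
    0# ∎
    where S = ∑[ i < suc n ] (F (suc (toℕ i)) * recips F n i)

  recips-cong : ∀ {F G} n → (∀ k → k ≤ n → F k ≈ G k) →
                ∀ i → recips F n i ≈ recips G n i
  recips-cong zero    F≈G zero    = refl
  recips-cong (suc n) F≈G zero    = -‿cong (sum-cong-≋ λ i →
    *-cong (F≈G _ (s≤s (toℕ≤pred[n] i)))
           (recips-cong n (λ k k≤n → F≈G k (ℕ.m≤n⇒m≤1+n k≤n)) i))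
  recips-cong (suc n) F≈G (suc i) =
    recips-cong n (λ k k≤n → F≈G k (ℕ.m≤n⇒m≤1+n k≤n)) i

  1-z-z²-cong : ∀ {a b F G} n → (∀ k → suc (suc k) ≤ n → F k ≈ G k) →
                ∀ k → k ≤ n → (1- a z- b z² F) k ≈ (1- a z- b z² G) k
  1-z-z²-cong n F≈G zero          k≤n = refl
  1-z-z²-cong n F≈G (suc zero)    k≤n = refl
  1-z-z²-cong n F≈G (suc (suc k)) k≤n = -‿cong (*-congˡ (F≈G k k≤n))

  convergent-stable : ∀ M N {α β n} → n < M → n < N →
                      convergent M α β n ≈ convergent N α β n
  convergent-stable (suc M) (suc N) {n = n} (s≤s n≤M) (s≤s n≤N) =
    recips-cong n (1-z-z²-cong n λ k 2+k≤n →
      convergent-stable M N (ℕ.<⇒≤ (ℕ.≤-trans 2+k≤n n≤M))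
                            (ℕ.<⇒≤ (ℕ.≤-trans 2+k≤n n≤N))) zero

  jFraction-unfold : ∀ α β →
    (1- α 0 z- β 1 z² jFraction (α ∘ suc) (β ∘ suc)) *ₛ jFraction α β ≈ₛ 1ₛ
  jFraction-unfold α β n = trans
    (sum-cong-≋ {suc n} λ i → *-congˡ {x = D (toℕ i)} (jFraction≈recip (n ∸ toℕ i)))
    (recip-inverse D refl n)
    where
    D : Series
    D = 1- α 0 z- β 1 z² jFraction (α ∘ suc) (β ∘ suc)

    jFraction≈recip : jFraction α β ≈ₛ recip D
    jFraction≈recip k = recips-cong k (1-z-z²-cong {α 0} {β 1} k λ l 2+l≤k →
      convergent-stable k (suc l) {α ∘ suc} {β ∘ suc} (ℕ.<⇒≤ 2+l≤k) ℕ.≤-refl) zero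

  module Coefficients (a b c d f g h ℓ p r s t u w : Carrier) where

    α β : ℕ → Carrier
    α n = u * w ^ n + s * [ n ]⟨ a , b ⟩ + t * [ n ]⟨ f , g ⟩
    β n = p * r * [ n ]⟨ c , d ⟩ * [ n ]⟨ h , ℓ ⟩

    𝒞 : Series
    𝒞 = jFraction α β

{-# OPTIONS --safe #-}

-- Let Cₖ be the tail of the continued fraction starting at αₖ, and put
-- qₖ = β₁⋯βₖ zᵏ C₀ C₁ ⋯ Cₖ.  The equations of the tails give
-- shift qₖ = qₖ₊₁ + αₖ qₖ + βₖ qₖ₋₁, where shift drops the constant term, so the
-- j-th column shiftʲ q₀ of the Hankel matrix is qⱼ plus a combination of
-- q₀ , … , qⱼ₋₁.  Column operations therefore turn the Hankel matrix into the
-- lower triangular matrix with columns qⱼ and diagonal entries β₁⋯βⱼ.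
module Submission where

open import Defs
open import Algebra.Bundles using (CommutativeRing)
open import Data.Fin.Base using (Fin; zero; suc; toℕ; fromℕ; inject₁; punchIn)
open import Data.Fin.Properties using (toℕ-inject₁; toℕ-fromℕ)
open import Data.List.Base using (List; []; _∷_; _++_; tabulate)
open import Data.List.Relation.Unary.All using (All; []; _∷_)
open import Data.Nat.Base as ℕ using (ℕ; zero; suc; _∸_; _≤_; _<_; s≤s)
open import Data.Nat.Combinatorics using (_C_; nC1≡n; nCk+nC[k+1]≡[n+1]C[k+1])
import Data.Nat.Properties as ℕ
open import Data.Product.Base using (∃; _×_; _,_)
open import Data.Sum.Base using (inj₁; inj₂)
open import Function.Base using (_∘_)
open import Level using (_⊔_)
open import Relation.Binary.PropositionalEquality.Core as ≡ using (_≡_)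

module HankelDeterminants {κ κ′} (R : CommutativeRing κ κ′) where

  open CommutativeRing R hiding (zero)
  open JFractions R
  open import Algebra.Properties.Ring ring
    using (-1*x≈-x; -‿distribˡ-*; -0#≈0#; -‿+-comm; +-inverseˡ-unique; x∙y⁻¹≈ε⇒x≈y)
  open import Algebra.Properties.Semiring.Sum semiring
    using (sum-cong-≋; sum-replicate-zero; *-distribˡ-sum)
  open import Algebra.Properties.Semiring.Exp semiring using (^-homo-*; ^-congʳ)
  open import Algebra.Properties.CommutativeMonoid.Sum *-commutativeMonoid
    using () renaming (sum to product; sum-cong-≋ to product-cong;
                       ∑-distrib-+ to ∏-distrib-*; sum-init-last to product-init-last)
  open import Relation.Binary.Reasoning.Setoid setoid
  open import Algebra.Solver.Ring.NaturalCoefficients.Default commutativeSemiring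
    using (solve; con; _:+_; _:*_; _:=_)

  -- Operations on series

  infixl 6 _+ₛ_
  infixl 7 _·ₛ_

  _+ₛ_ : Series → Series → Series
  (F +ₛ G) n = F n + G n

  _·ₛ_ : Carrier → Series → Series
  (a ·ₛ F) n = a * F n

  shift : Series → Series
  shift F n = F (suc n)

  z·_ : Series → Series
  (z· F) zero    = 0#
  (z· F) (suc n) = F n

  -- The convolution unfolds definitionally to `F 0 * K (suc n) + (shift F *ₛ K) n`, so induction on
  -- the coefficient shifts the left factors. The linear relation is a hypothesis so that it can be
  -- shifted along with them.
  *ₛ-linearˡ : ∀ {a F G H} K → F ≈ₛ a ·ₛ G +ₛ H →
               F *ₛ K ≈ₛ a ·ₛ (G *ₛ K) +ₛ (H *ₛ K)
  *ₛ-linearˡ {a} {F} {G} {H} K F≈ zero = begin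
    F 0 * K 0 + 0#                         ≈⟨ +-identityʳ _ ⟩
    F 0 * K 0                              ≈⟨ *-congʳ (F≈ 0) ⟩
    (a * G 0 + H 0) * K 0
      ≈⟨ solve 4 (λ a x y z → (a :* x :+ y) :* z := a :* (x :* z) :+ y :* z)
           refl a (G 0) (H 0) (K 0) ⟩
    a * (G 0 * K 0) + H 0 * K 0
      ≈⟨ +-cong (*-congˡ (+-identityʳ _)) (+-identityʳ _) ⟨
    a * (G 0 * K 0 + 0#) + (H 0 * K 0 + 0#) ∎
  *ₛ-linearˡ {a} {F} {G} {H} K F≈ (suc n) = begin
    F 0 * K (suc n) + (shift F *ₛ K) n
      ≈⟨ +-cong (*-congʳ (F≈ 0)) (*ₛ-linearˡ K (F≈ ∘ suc) n) ⟩
    (a * G 0 + H 0) * K (suc n) + (a * (shift G *ₛ K) n + (shift H *ₛ K) n)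
      ≈⟨ solve 6 (λ a x y z u v → (a :* x :+ y) :* z :+ (a :* u :+ v)
                                    := a :* (x :* z :+ u) :+ (y :* z :+ v))
           refl a (G 0) (H 0) (K (suc n)) _ _ ⟩
    a * (G *ₛ K) (suc n) + (H *ₛ K) (suc n) ∎

  *ₛ-zeroˡ : ∀ K → 0ₛ *ₛ K ≈ₛ 0ₛ
  *ₛ-zeroˡ K zero    = trans (+-identityʳ _) (zeroˡ _)
  *ₛ-zeroˡ K (suc n) = trans (+-cong (zeroˡ _) (*ₛ-zeroˡ K n)) (+-identityʳ 0#)

  *ₛ-scaleˡ : ∀ {a F G} K → F ≈ₛ a ·ₛ G → F *ₛ K ≈ₛ a ·ₛ (G *ₛ K)
  *ₛ-scaleˡ {a} {F} {G} K F≈ n = trans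
    (*ₛ-linearˡ {a} {F} {G} {0ₛ} K (λ i → trans (F≈ i) (sym (+-identityʳ _))) n)
    (trans (+-congˡ (*ₛ-zeroˡ K n)) (+-identityʳ _))

  *ₛ-assoc : ∀ F G H → (F *ₛ G) *ₛ H ≈ₛ F *ₛ (G *ₛ H)
  *ₛ-assoc F G H zero =
    solve 3 (λ x y z → (x :* y :+ con 0) :* z :+ con 0 := x :* (y :* z :+ con 0) :+ con 0)
      refl (F 0) (G 0) (H 0)
  *ₛ-assoc F G H (suc n) = begin
    (F 0 * G 0 + 0#) * H (suc n) + (shift (F *ₛ G) *ₛ H) n
      -- Coefficientwise, `shift (F *ₛ G)` is by definition `F 0 ·ₛ shift G +ₛ shift F *ₛ G`.
      ≈⟨ +-congˡ (*ₛ-linearˡ {F 0} {shift (F *ₛ G)} {shift G} {shift F *ₛ G} H (λ _ → refl) n) ⟩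
    (F 0 * G 0 + 0#) * H (suc n) + (F 0 * (shift G *ₛ H) n + ((shift F *ₛ G) *ₛ H) n)
      ≈⟨ +-congˡ (+-congˡ (*ₛ-assoc (shift F) G H n)) ⟩
    (F 0 * G 0 + 0#) * H (suc n) + (F 0 * (shift G *ₛ H) n + (shift F *ₛ (G *ₛ H)) n)
      ≈⟨ solve 5 (λ x y z u v → (x :* y :+ con 0) :* z :+ (x :* u :+ v)
                                  := x :* (y :* z :+ u) :+ v)
           refl (F 0) (G 0) (H (suc n)) _ _ ⟩
    F 0 * (G 0 * H (suc n) + (shift G *ₛ H) n) + (shift F *ₛ (G *ₛ H)) n ∎

  z·-*ₛ : ∀ F G → (z· F) *ₛ G ≈ₛ z· (F *ₛ G)
  z·-*ₛ F G zero    = trans (+-identityʳ _) (zeroˡ _)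
  z·-*ₛ F G (suc n) = trans (+-congʳ (zeroˡ _)) (+-identityˡ _)

  z·-cong : ∀ {F G} → F ≈ₛ G → z· F ≈ₛ z· G
  z·-cong F≈G zero    = refl
  z·-cong F≈G (suc n) = F≈G n

  *ₛ-z· : ∀ F G → F *ₛ (z· G) ≈ₛ z· (F *ₛ G)
  *ₛ-z· F G zero          = trans (+-identityʳ _) (zeroʳ _)
  *ₛ-z· F G (suc zero)    = +-congˡ (*ₛ-z· (shift F) G zero)
  *ₛ-z· F G (suc (suc n)) = +-congˡ (*ₛ-z· (shift F) G (suc n))

  -- All terms of the convolution but the first contain a coefficient of `G` of index below `n`.
  *ₛ-lowest : ∀ F G n → (∀ i → i < n → G i ≈ 0#) → (F *ₛ G) n ≈ F 0 * G n
  *ₛ-lowest F G zero    G≈0 = +-identityʳ _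
  *ₛ-lowest F G (suc n) G≈0 = begin
    F 0 * G (suc n) + (shift F *ₛ G) n
      ≈⟨ +-congˡ (sum-cong-≋ {suc n} λ i → trans
           (*-congˡ {F (suc (toℕ i))} (G≈0 (n ∸ toℕ i) (s≤s (ℕ.m∸n≤m n (toℕ i))))) (zeroʳ _)) ⟩
    F 0 * G (suc n) + ∑[ i < suc n ] 0#
      ≈⟨ +-congˡ (sum-replicate-zero (suc n)) ⟩
    F 0 * G (suc n) + 0#
      ≈⟨ +-identityʳ _ ⟩
    F 0 * G (suc n) ∎

  -- Determinants

  -- Expansion along row r, where D is the determinant of the rows below.
  expand : ℕ → (List Series → Carrier) → List Series → Carrier
  expand r D []       = 0#
  expand r D (c ∷ cs) = c r * D cs + - 1# * expand r (D ∘ (c ∷_)) cs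

  -- The determinant of n columns restricted to the rows r, …, r + n - 1; the value 0
  -- of  minor zero  on a nonempty list only serves to make it alternating.
  minor : ℕ → ℕ → List Series → Carrier
  minor zero    r []      = 1#
  minor zero    r (_ ∷ _) = 0#
  minor (suc n) r cs      = expand r (minor n (suc r)) cs

  sign : ∀ {n} → Fin n → Carrier
  sign j = (- 1#) ^ toℕ j

  -- The sign of a cofactor arises in `expand` as one factor `- 1#` per column passed. Passing a
  -- column also absorbs it into `D`, hence the induction is over all `D`.
  expand-tabulate : ∀ {n} r D (c : Fin (suc n) → Series) →
    ∑[ j < suc n ] (sign j * c j r * D (tabulate (c ∘ punchIn j)))
      ≈ expand r D (tabulate c)
  expand-tabulate {zero} r D c =
    +-cong (*-congʳ (*-identityˡ _)) (sym (zeroʳ _))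
  expand-tabulate {suc n} r D c =
    +-cong (*-congʳ (*-identityˡ _)) (begin
      ∑[ j < suc n ] (- 1# * sign j * c (suc j) r * D (tabulate (c ∘ punchIn (suc j))))
        ≈⟨ sum-cong-≋ {suc n} (λ j → trans
             (*-congʳ {D′ (tabulate (c ∘ suc ∘ punchIn j))} (*-assoc (- 1#) (sign j) _))
             (*-assoc (- 1#) (sign j * c (suc j) r) _)) ⟩
      ∑[ j < suc n ] (- 1# * (sign j * c (suc j) r * D′ (tabulate (c ∘ suc ∘ punchIn j))))
        ≈⟨ *-distribˡ-sum {suc n} (- 1#)
             (λ j → sign j * c (suc j) r * D′ (tabulate (c ∘ suc ∘ punchIn j))) ⟨
      - 1# * ∑[ j < suc n ] (sign j * c (suc j) r * D′ (tabulate (c ∘ suc ∘ punchIn j)))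
        ≈⟨ *-congˡ (expand-tabulate r D′ (c ∘ suc)) ⟩
      - 1# * expand r D′ (tabulate (c ∘ suc)) ∎)
    where
    D′ : List Series → Carrier
    D′ = D ∘ (c zero ∷_)

  det≈minor : ∀ {n} r (M : Matrix n) c → (∀ i j → M i j ≈ c j (toℕ i ℕ.+ r)) →
              det M ≈ minor n r (tabulate c)
  det≈minor {zero}  r M c M≈c = refl
  det≈minor {suc n} r M c M≈c = trans
    (sum-cong-≋ {suc n} λ j → *-cong (*-congˡ {sign j} (M≈c zero j))
      (det≈minor (suc r) _ (c ∘ punchIn j) λ i k →
        trans (M≈c (suc i) (punchIn j k))
              (reflexive (≡.cong (c (punchIn j k)) (≡.sym (ℕ.+-suc (toℕ i) r))))))
    (expand-tabulate r (minor n (suc r)) c)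

  -- Stating linearity through `u ≈ₛ a ·ₛ v +ₛ w` covers additivity, homogeneity and compatibility
  -- with `≈ₛ` in one law. Lists of arbitrary length let a functional with its first column fixed be
  -- of the same kind.
  record Alternating (D : List Series → Carrier) : Set (κ ⊔ κ′) where
    field
      linear : ∀ xs ys {a u v w} → u ≈ₛ a ·ₛ v +ₛ w →
               D (xs ++ u ∷ ys) ≈ a * D (xs ++ v ∷ ys) + D (xs ++ w ∷ ys)
      adjacent : ∀ xs ys v → D (xs ++ v ∷ v ∷ ys) ≈ 0#

  open Alternating

  alternating-∷ : ∀ {D} → Alternating D → ∀ c → Alternating (D ∘ (c ∷_))
  alternating-∷ alt c .linear   xs = alt .linear (c ∷ xs)
  alternating-∷ alt c .adjacent xs = alt .adjacent (c ∷ xs)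

  -- When the leading column of a determinant is a combination, all later terms of the expansion see
  -- it only through the functional, so linearity in the functional is needed.
  expand-linear : ∀ r {a D E F} → (∀ cs → D cs ≈ a * E cs + F cs) →
                  ∀ cs → expand r D cs ≈ a * expand r E cs + expand r F cs
  expand-linear r {a} D≈ [] = sym (trans (+-identityʳ _) (zeroʳ a))
  expand-linear r {a} {D} {E} {F} D≈ (c ∷ cs) = begin
    c r * D cs + - 1# * expand r (D ∘ (c ∷_)) cs
      ≈⟨ +-cong (*-congˡ (D≈ cs)) (*-congˡ (expand-linear r (D≈ ∘ (c ∷_)) cs)) ⟩
    c r * (a * E cs + F cs)
      + - 1# * (a * expand r (E ∘ (c ∷_)) cs + expand r (F ∘ (c ∷_)) cs)
      ≈⟨ solve 7 (λ x a e f y e′ f′ → x :* (a :* e :+ f) :+ y :* (a :* e′ :+ f′)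
                    := a :* (x :* e :+ y :* e′) :+ (x :* f :+ y :* f′))
           refl (c r) a (E cs) (F cs) (- 1#) _ _ ⟩
    a * expand r E (c ∷ cs) + expand r F (c ∷ cs) ∎

  expand-zero : ∀ r {D} → (∀ cs → D cs ≈ 0#) → ∀ cs → expand r D cs ≈ 0#
  expand-zero r D≈0 []       = refl
  expand-zero r D≈0 (c ∷ cs) = trans
    (+-cong (trans (*-congˡ (D≈0 cs)) (zeroʳ _))
            (trans (*-congˡ (expand-zero r (D≈0 ∘ (c ∷_)) cs)) (zeroʳ _)))
    (+-identityʳ 0#)

  expand-alternating : ∀ r {D} → Alternating D → Alternating (expand r D)
  expand-alternating r {D} alt .linear [] ys {a} {u} {v} {w} u≈ = begin
    u r * D ys + - 1# * expand r (D ∘ (u ∷_)) ys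
      ≈⟨ +-cong (*-congʳ (u≈ r))
                (*-congˡ (expand-linear r (λ cs → alt .linear [] cs u≈) ys)) ⟩
    (a * v r + w r) * D ys + - 1# * (a * expand r (D ∘ (v ∷_)) ys + expand r (D ∘ (w ∷_)) ys)
      ≈⟨ solve 7 (λ a x y d e f g → (a :* x :+ y) :* d :+ e :* (a :* f :+ g)
                    := a :* (x :* d :+ e :* f) :+ (y :* d :+ e :* g))
           refl a (v r) (w r) (D ys) (- 1#) _ _ ⟩
    a * expand r D (v ∷ ys) + expand r D (w ∷ ys) ∎
  expand-alternating r {D} alt .linear (x ∷ xs) ys {a} {u} {v} {w} u≈ = begin
    x r * D (xs ++ u ∷ ys) + - 1# * expand r (D ∘ (x ∷_)) (xs ++ u ∷ ys)
      ≈⟨ +-cong (*-congˡ (alt .linear xs ys u≈))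
                (*-congˡ (expand-alternating r (alternating-∷ alt x) .linear xs ys u≈)) ⟩
    x r * (a * D (xs ++ v ∷ ys) + D (xs ++ w ∷ ys))
      + - 1# * (a * expand r (D ∘ (x ∷_)) (xs ++ v ∷ ys)
                + expand r (D ∘ (x ∷_)) (xs ++ w ∷ ys))
      ≈⟨ solve 7 (λ x a e f y e′ f′ → x :* (a :* e :+ f) :+ y :* (a :* e′ :+ f′)
                    := a :* (x :* e :+ y :* e′) :+ (x :* f :+ y :* f′))
           refl (x r) a _ _ (- 1#) _ _ ⟩
    a * expand r D (x ∷ xs ++ v ∷ ys) + expand r D (x ∷ xs ++ w ∷ ys) ∎
  -- The two terms that delete one copy of `v` cancel. In every other term both copies are passed to
  -- `D`, which vanishes on them.
  expand-alternating r {D} alt .adjacent [] ys v = begin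
    v r * D (v ∷ ys) + - 1# * (v r * D (v ∷ ys) + - 1# * expand r (D ∘ (v ∷_) ∘ (v ∷_)) ys)
      ≈⟨ +-congˡ (*-congˡ (+-congˡ (trans
           (*-congˡ (expand-zero r (λ cs → alt .adjacent [] cs v) ys)) (zeroʳ _)))) ⟩
    v r * D (v ∷ ys) + - 1# * (v r * D (v ∷ ys) + 0#)
      ≈⟨ +-congˡ (trans (-1*x≈-x _) (-‿cong (+-identityʳ _))) ⟩
    v r * D (v ∷ ys) + - (v r * D (v ∷ ys))
      ≈⟨ -‿inverseʳ _ ⟩
    0# ∎
  expand-alternating r alt .adjacent (x ∷ xs) ys v = trans
    (+-cong (trans (*-congˡ (alt .adjacent xs ys v)) (zeroʳ _))
            (trans (*-congˡ (expand-alternating r (alternating-∷ alt x) .adjacent xs ys v))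
                   (zeroʳ _)))
    (+-identityʳ 0#)

  minor-alternating : ∀ n r → Alternating (minor n r)
  minor-alternating zero r .linear []      ys {a} _ = sym (trans (+-identityʳ _) (zeroʳ a))
  minor-alternating zero r .linear (_ ∷ _) ys {a} _ = sym (trans (+-identityʳ _) (zeroʳ a))
  minor-alternating zero r .adjacent []      ys v = refl
  minor-alternating zero r .adjacent (_ ∷ _) ys v = refl
  minor-alternating (suc n) r = expand-alternating r (minor-alternating n (suc r))

  module _ {D} (alt : Alternating D) where

    additive : ∀ xs ys {u v w} → u ≈ₛ v +ₛ w →
               D (xs ++ u ∷ ys) ≈ D (xs ++ v ∷ ys) + D (xs ++ w ∷ ys)
    additive xs ys u≈ = trans
      (alt .linear xs ys (λ n → trans (u≈ n) (+-congʳ (sym (*-identityˡ _)))))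
      (+-congʳ (*-identityˡ _))

    -- A zero column satisfies `v = - v + v`, so linearity gives its value as a sum of two opposite
    -- terms.
    null-column : ∀ xs ys {v} → v ≈ₛ 0ₛ → D (xs ++ v ∷ ys) ≈ 0#
    null-column xs ys {v} v≈0 = begin
      D (xs ++ v ∷ ys)
        ≈⟨ alt .linear xs ys {a = - 1#} {v = v} (λ n → begin
             v n                ≈⟨ v≈0 n ⟩
             0#                 ≈⟨ -‿inverseˡ _ ⟨
             - v n + v n        ≈⟨ +-congʳ (-1*x≈-x _) ⟨
             - 1# * v n + v n   ∎) ⟩
      - 1# * D (xs ++ v ∷ ys) + D (xs ++ v ∷ ys)  ≈⟨ +-congʳ (-1*x≈-x _) ⟩
      - D (xs ++ v ∷ ys) + D (xs ++ v ∷ ys)       ≈⟨ -‿inverseˡ _ ⟩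
      0#                                          ∎

    -- Polarisation: expanding the vanishing value on two adjacent copies of `u +ₛ v` leaves just
    -- the two mixed terms.
    transpose : ∀ u v ys → D (u ∷ v ∷ ys) ≈ - D (v ∷ u ∷ ys)
    transpose u v ys = +-inverseˡ-unique _ _ (begin
      D (u ∷ v ∷ ys) + D (v ∷ u ∷ ys)
        ≈⟨ +-cong (trans (+-congʳ (alt .adjacent [] ys u)) (+-identityˡ _))
                  (trans (+-congˡ (alt .adjacent [] ys v)) (+-identityʳ _)) ⟨
      (D (u ∷ u ∷ ys) + D (u ∷ v ∷ ys)) + (D (v ∷ u ∷ ys) + D (v ∷ v ∷ ys))
        ≈⟨ +-cong (additive (u ∷ []) ys (λ _ → refl)) (additive (v ∷ []) ys (λ _ → refl)) ⟨
      D (u ∷ u +ₛ v ∷ ys) + D (v ∷ u +ₛ v ∷ ys)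
        ≈⟨ additive [] _ (λ _ → refl) ⟨
      D (u +ₛ v ∷ u +ₛ v ∷ ys)
        ≈⟨ alt .adjacent [] ys (u +ₛ v) ⟩
      0# ∎)

  -- The leading `v` is exchanged with its neighbour `x`, and `x` is then absorbed into the
  -- functional, until the two copies are adjacent.
  repeated : ∀ {D} → Alternating D → ∀ v xs ys → D (v ∷ xs ++ v ∷ ys) ≈ 0#
  repeated alt v []       ys = alt .adjacent [] ys v
  repeated alt v (x ∷ xs) ys = trans (transpose alt v x _)
    (trans (-‿cong (repeated (alternating-∷ alt x) v xs ys)) -0#≈0#)

  -- Spans of initial segments of a sequence of columns

  -- Combinations are built one term at a time, in any order and with repetitions, so that each
  -- constructor matches one use of linearity.
  data Span (q : ℕ → Series) (r : ℕ) : Series → Set (κ ⊔ κ′) where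
    null : ∀ {v} → v ≈ₛ 0ₛ → Span q r v
    term : ∀ {v w} k → k < r → ∀ a → v ≈ₛ a ·ₛ q k +ₛ w → Span q r w → Span q r v

  span-resp : ∀ {q r v w} → w ≈ₛ v → Span q r v → Span q r w
  span-resp w≈v (null v≈0)          = null (λ n → trans (w≈v n) (v≈0 n))
  span-resp w≈v (term k k<r a v≈ s) = term k k<r a (λ n → trans (w≈v n) (v≈ n)) s

  span-weaken : ∀ {q r s v} → r ≤ s → Span q r v → Span q s v
  span-weaken r≤s (null v≈0)          = null v≈0
  span-weaken r≤s (term k k<r a v≈ t) =
    term k (ℕ.≤-trans k<r r≤s) a v≈ (span-weaken r≤s t)

  span-basis : ∀ {q r} k → k < r → Span q r (q k)
  span-basis k k<r = term k k<r 1#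
    (λ n → sym (trans (+-identityʳ _) (*-identityˡ _))) (null {v = λ _ → 0#} (λ _ → refl))

  span-linear : ∀ {q r u v} a → Span q r u → Span q r v → Span q r (a ·ₛ u +ₛ v)
  span-linear a (null u≈0) t =
    span-resp (λ n → trans (+-congʳ (trans (*-congˡ (u≈0 n)) (zeroʳ a))) (+-identityˡ _)) t
  span-linear {q} {v = v} a (term {w = w} k k<r b u≈ s) t =
    term k k<r (a * b)
      (λ n → trans (+-congʳ (*-congˡ (u≈ n)))
        (solve 5 (λ a b x y z → a :* (b :* x :+ y) :+ z := a :* b :* x :+ (a :* y :+ z))
           refl a b (q k n) (w n) (v n)))
      (span-linear a s t)

  -- Shifting is linear, and a term `q k` with `k < r` goes to the span with bound `suc (suc k)`,
  -- which is at most `suc r`.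
  span-shift : ∀ {q} → (∀ k → Span q (suc (suc k)) (shift (q k))) →
               ∀ {r v} → Span q r v → Span q (suc r) (shift v)
  span-shift shift-q (null v≈0)          = null (v≈0 ∘ suc)
  span-shift shift-q (term k k<r a v≈ s) = span-resp (v≈ ∘ suc)
    (span-linear a (span-weaken (s≤s k<r) (shift-q k)) (span-shift shift-q s))

  -- Quantifying over all positions makes the property survive the absorption of a leading column
  -- into `D`.
  Vanishes : (List Series → Carrier) → Series → Set (κ ⊔ κ′)
  Vanishes D v = ∀ xs ys → D (xs ++ v ∷ ys) ≈ 0#

  span-vanishes : ∀ {D q r} → Alternating D → (∀ i → i < r → Vanishes D (q i)) →
                  ∀ {v} → Span q r v → Vanishes D v
  span-vanishes alt q-vanishes (null v≈0) xs ys = null-column alt xs ys v≈0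
  span-vanishes alt q-vanishes (term k k<r a v≈ s) xs ys = trans
    (alt .linear xs ys v≈)
    (trans (+-cong (trans (*-congˡ (q-vanishes k k<r xs ys)) (zeroʳ a))
                   (span-vanishes alt q-vanishes s xs ys))
           (+-identityʳ 0#))

  -- Column reduction to triangular form

  columns : (ℕ → Series) → ℕ → ℕ → List Series
  columns q r zero    = []
  columns q r (suc n) = q r ∷ columns q (suc r) n

  tabulate≡columns : ∀ n (x : ℕ → Series) r (c : Fin n → Series) →
                     (∀ j → c j ≡ x (toℕ j ℕ.+ r)) → tabulate c ≡ columns x r n
  tabulate≡columns zero    x r c c≡ = ≡.refl
  tabulate≡columns (suc n) x r c c≡ = ≡.cong₂ _∷_ (c≡ zero)
    (tabulate≡columns n x (suc r) (c ∘ suc)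
      λ j → ≡.trans (c≡ (suc j)) (≡.cong x (≡.sym (ℕ.+-suc (toℕ j) r))))

  -- The columns are replaced from left to right. At index `r` the columns `q 0`, ..., `q (r - 1)`
  -- are already absorbed into `D`, so `D` vanishes on their span and the correction in `x r`
  -- contributes nothing.
  column-reduction : ∀ {D x q} → Alternating D →
    (∀ k → ∃ λ v → Span q k v × x k ≈ₛ q k +ₛ v) →
    ∀ n r → (∀ i → i < r → Vanishes D (q i)) → D (columns x r n) ≈ D (columns q r n)
  column-reduction alt x-unitriangular zero r q-vanishes = refl
  column-reduction {D} {x} {q} alt x-unitriangular (suc n) r q-vanishes
    with v , s , x≈ ← x-unitriangular r = begin
    D (x r ∷ columns x (suc r) n)
      ≈⟨ additive alt [] _ x≈ ⟩
    D (q r ∷ columns x (suc r) n) + D (v ∷ columns x (suc r) n)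
      ≈⟨ +-congˡ (span-vanishes alt q-vanishes s [] _) ⟩
    D (q r ∷ columns x (suc r) n) + 0#
      ≈⟨ +-identityʳ _ ⟩
    D (q r ∷ columns x (suc r) n)
      ≈⟨ column-reduction (alternating-∷ alt (q r)) x-unitriangular n (suc r) q-vanishes′ ⟩
    D (q r ∷ columns q (suc r) n) ∎
    where
    q-vanishes′ : ∀ i → i < suc r → Vanishes (D ∘ (q r ∷_)) (q i)
    q-vanishes′ i i<1+r with ℕ.m<1+n⇒m<n∨m≡n i<1+r
    ... | inj₁ i<r    = λ xs → q-vanishes i i<r (q r ∷ xs)
    ... | inj₂ ≡.refl = repeated alt (q r)

  -- Each term after the first has as a factor the entry in row `r` of one of the columns `cs`. The
  -- helper `go` is over all functionals because the expansion keeps absorbing columns.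
  expand-lowerTriangular : ∀ r D c {cs} → All (λ c′ → c′ r ≈ 0#) cs →
                           expand r D (c ∷ cs) ≈ c r * D cs
  expand-lowerTriangular r D c {cs} cs≈0 =
    trans (+-congˡ (trans (*-congˡ (go _ cs≈0)) (zeroʳ _))) (+-identityʳ _)
    where
    go : ∀ D {cs} → All (λ c′ → c′ r ≈ 0#) cs → expand r D cs ≈ 0#
    go D []             = refl
    go D (c≈0 ∷ cs≈0) = trans
      (+-cong (trans (*-congʳ c≈0) (zeroˡ _)) (trans (*-congˡ (go _ cs≈0)) (zeroʳ _)))
      (+-identityʳ 0#)

  minor-lowerTriangular : ∀ {q} → (∀ k i → i < k → q k i ≈ 0#) → ∀ n r →
    minor n r (columns q r n) ≈ ∏[ k < n ] q (toℕ k ℕ.+ r) (toℕ k ℕ.+ r)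
  minor-lowerTriangular lower zero    r = refl
  minor-lowerTriangular {q} lower (suc n) r = begin
    minor (suc n) r (columns q r (suc n))
      ≈⟨ expand-lowerTriangular r (minor n (suc r)) (q r) (zeros n (suc r) ℕ.≤-refl) ⟩
    q r r * minor n (suc r) (columns q (suc r) n)
      ≈⟨ *-congˡ (minor-lowerTriangular lower n (suc r)) ⟩
    q r r * ∏[ k < n ] q (toℕ k ℕ.+ suc r) (toℕ k ℕ.+ suc r)
      ≈⟨ *-congˡ (product-cong {n} λ k → reflexive (≡.cong (λ l → q l l) (ℕ.+-suc (toℕ k) r))) ⟩
    q r r * ∏[ k < n ] q (suc (toℕ k ℕ.+ r)) (suc (toℕ k ℕ.+ r)) ∎
    where
    zeros : ∀ m s → r < s → All (λ c → c r ≈ 0#) (columns q s m)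
    zeros zero    s r<s = []
    zeros (suc m) s r<s = lower s r r<s ∷ zeros m (suc s) (ℕ.m≤n⇒m≤1+n r<s)

  -- The continued fraction will enter only through these hypotheses: triangularity of `q`, and a
  -- shift that raises the index by one modulo the terms up to `q k`.
  hankel-det : ∀ m q → m ≈ₛ q 0 →
    (∀ k i → i < k → q k i ≈ 0#) →
    (∀ k → ∃ λ w → Span q (suc k) w × shift (q k) ≈ₛ q (suc k) +ₛ w) →
    ∀ n → det {n} (λ i j → m (toℕ i ℕ.+ toℕ j)) ≈ ∏[ k < n ] q (toℕ k) (toℕ k)
  hankel-det m q m≈q₀ lower shift-q n = begin
    det {n} (λ i j → m (toℕ i ℕ.+ toℕ j))
      ≈⟨ det≈minor {n} 0 (λ i j → m (toℕ i ℕ.+ toℕ j)) (x ∘ toℕ)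
           (λ i j → reflexive (≡.cong (λ l → m (l ℕ.+ toℕ j)) (≡.sym (ℕ.+-identityʳ (toℕ i))))) ⟩
    minor n 0 (tabulate (x ∘ toℕ))
      ≡⟨ ≡.cong (minor n 0) (tabulate≡columns n x 0 (x ∘ toℕ)
           λ j → ≡.cong x (≡.sym (ℕ.+-identityʳ (toℕ j)))) ⟩
    minor n 0 (columns x 0 n)
      ≈⟨ column-reduction (minor-alternating n 0) x-unitriangular n 0 (λ _ ()) ⟩
    minor n 0 (columns q 0 n)
      ≈⟨ minor-lowerTriangular lower n 0 ⟩
    ∏[ k < n ] q (toℕ k ℕ.+ 0) (toℕ k ℕ.+ 0)
      ≈⟨ product-cong {n} (λ k → reflexive (≡.cong (λ l → q l l) (ℕ.+-identityʳ (toℕ k)))) ⟩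
    ∏[ k < n ] q (toℕ k) (toℕ k) ∎
    where
    x : ℕ → Series
    x j i = m (i ℕ.+ j)

    shift-span : ∀ k → Span q (suc (suc k)) (shift (q k))
    shift-span k with w , s , q≈ ← shift-q k =
      span-resp (λ n → trans (q≈ n) (+-congʳ (sym (*-identityˡ _))))
        (span-linear 1# (span-basis (suc k) ℕ.≤-refl) (span-weaken (ℕ.n≤1+n _) s))

    x-unitriangular : ∀ k → ∃ λ v → Span q k v × x k ≈ₛ q k +ₛ v
    x-unitriangular zero = 0ₛ , null (λ _ → refl) , λ i →
      trans (reflexive (≡.cong m (ℕ.+-identityʳ i))) (trans (m≈q₀ i) (sym (+-identityʳ _)))
    -- Shifting `q k +ₛ v` gives `q (suc k)`, the remainder `w` of `shift-q`, and `shift v`, which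
    -- `span-shift` controls. The factor `1#` gives the sum the shape required by `span-linear`.
    x-unitriangular (suc k)
      with v , s , x≈ ← x-unitriangular k | w , t , q≈ ← shift-q k =
      1# ·ₛ w +ₛ shift v , span-linear 1# t (span-shift shift-span s) , λ i → begin
        m (i ℕ.+ suc k)                         ≡⟨ ≡.cong m (ℕ.+-suc i k) ⟩
        x k (suc i)                             ≈⟨ x≈ (suc i) ⟩
        q k (suc i) + v (suc i)                 ≈⟨ +-congʳ (q≈ i) ⟩
        (q (suc k) i + w i) + v (suc i)         ≈⟨ +-assoc _ _ _ ⟩
        q (suc k) i + (w i + v (suc i))         ≈⟨ +-congˡ (+-congʳ (*-identityˡ _)) ⟨
        q (suc k) i + (1# * w i + v (suc i))    ∎

  -- Jacobi continued fractions

  jFraction-head : ∀ {a b F G} → (1- a z- b z² G) *ₛ F ≈ₛ 1ₛ → F 0 ≈ 1#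
  jFraction-head unfold = trans (sym (trans (+-identityʳ _) (*-identityˡ _))) (unfold 0)

  -- This is the coefficient of index `suc n` in the equation for `F`, solved for `F (suc n)`, whose
  -- coefficient there is the constant term 1 of the denominator.
  jFraction-shift : ∀ {a b F G} → (1- a z- b z² G) *ₛ F ≈ₛ 1ₛ →
                    shift F ≈ₛ a ·ₛ F +ₛ b ·ₛ z· (G *ₛ F)
  jFraction-shift {a} {b} {F} {G} unfold n = x∙y⁻¹≈ε⇒x≈y _ _ (begin
    F (suc n) + - (a * F n + b * (z· (G *ₛ F)) n)
      ≈⟨ +-cong (*-identityˡ _) (negated n) ⟨
    1# * F (suc n) + (shift (1- a z- b z² G) *ₛ F) n
      ≈⟨ unfold (suc n) ⟩
    0# ∎)
    where
    negated : ∀ n → (shift (1- a z- b z² G) *ₛ F) n ≈ - (a * F n + b * (z· (G *ₛ F)) n)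
    negated zero = begin
      - a * F 0 + 0#          ≈⟨ +-identityʳ _ ⟩
      - a * F 0               ≈⟨ -‿distribˡ-* a _ ⟨
      - (a * F 0)             ≈⟨ -‿cong (trans (+-congˡ (zeroʳ b)) (+-identityʳ _)) ⟨
      - (a * F 0 + b * 0#)    ∎
    negated (suc n) = begin
      - a * F (suc n) + (shift (shift (1- a z- b z² G)) *ₛ F) n
        -- Two shifts remove `1 - a z` from the denominator and leave the multiple `- b` of `G`.
        ≈⟨ +-congˡ (*ₛ-scaleˡ {(- b)} {shift (shift (1- a z- b z² G))} {G} F
                              (λ i → -‿distribˡ-* b (G i)) n) ⟩
      - a * F (suc n) + - b * (G *ₛ F) n
        ≈⟨ +-cong (-‿distribˡ-* a _) (-‿distribˡ-* b _) ⟨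
      - (a * F (suc n)) + - (b * (G *ₛ F) n)
        ≈⟨ -‿+-comm _ _ ⟩
      - (a * F (suc n) + b * (G *ₛ F) n) ∎

  weight : (ℕ → Carrier) → ℕ → Carrier
  weight β zero    = 1#
  weight β (suc k) = β (suc k) * weight β k

  -- `C k` stands for the tail of the fraction that starts at `α k`, given by its defining equation.
  module _ (α β : ℕ → Carrier) (C : ℕ → Series)
           (unfold : ∀ k → (1- α k z- β (suc k) z² C (suc k)) *ₛ C k ≈ₛ 1ₛ) where

    -- zᵏ C₀ ⋯ Cₖ
    p : ℕ → Series
    p zero    = C 0
    p (suc k) = z· (C (suc k) *ₛ p k)

    p-lower : ∀ k i → i < k → p k i ≈ 0#
    p-lower (suc k) zero    _         = refl
    p-lower (suc k) (suc i) (s≤s i<k) = begin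
      (C (suc k) *ₛ p k) i    ≈⟨ *ₛ-lowest (C (suc k)) _ i (λ j j<i →
                                   p-lower k j (ℕ.<-trans j<i i<k)) ⟩
      C (suc k) 0 * p k i     ≈⟨ *-congˡ (p-lower k i i<k) ⟩
      C (suc k) 0 * 0#        ≈⟨ zeroʳ _ ⟩
      0#                      ∎

    p-diagonal : ∀ k → p k k ≈ 1#
    p-diagonal zero    = jFraction-head {G = C 1} (unfold 0)
    p-diagonal (suc k) = begin
      (C (suc k) *ₛ p k) k    ≈⟨ *ₛ-lowest (C (suc k)) _ k (p-lower k) ⟩
      C (suc k) 0 * p k k     ≈⟨ *-cong (jFraction-head {G = C (2 ℕ.+ k)} (unfold (suc k)))
                                        (p-diagonal k) ⟩
      1# * 1#                 ≈⟨ *-identityˡ 1# ⟩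
      1#                      ∎

    -- The left side is `C (suc k) *ₛ p k`. The constant term 1 of `C (suc k)` contributes `p k`,
    -- and the recurrence for `shift (C (suc k))` turns the rest into the other two terms.
    p-shift : ∀ k → shift (p (suc k)) ≈ₛ
                    p k +ₛ (α (suc k) ·ₛ p (suc k) +ₛ β (suc (suc k)) ·ₛ p (suc (suc k)))
    p-shift k zero = begin
      C (suc k) 0 * p k 0 + 0#
        ≈⟨ +-cong (trans (*-congʳ (jFraction-head {G = C (2 ℕ.+ k)} (unfold (suc k))))
                         (*-identityˡ _))
                  (trans (sym (+-identityʳ 0#)) (sym (+-cong (zeroʳ _) (zeroʳ _)))) ⟩
      p k 0 + (α (suc k) * 0# + β (suc (suc k)) * 0#) ∎
    p-shift k (suc n) = begin
      F 0 * p k (suc n) + (shift F *ₛ p k) n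
        ≈⟨ +-cong (trans (*-congʳ (jFraction-head {G = G} (unfold (suc k)))) (*-identityˡ _))
             (*ₛ-linearˡ {α (suc k)} {shift F} {F} {b ·ₛ z· (G *ₛ F)} (p k)
                         (jFraction-shift {α (suc k)} {b} {F} {G} (unfold (suc k))) n) ⟩
      p k (suc n) + (α (suc k) * (F *ₛ p k) n + ((b ·ₛ z· (G *ₛ F)) *ₛ p k) n)
        ≈⟨ +-congˡ (+-congˡ (*ₛ-scaleˡ {b} {_} {z· (G *ₛ F)} (p k) (λ _ → refl) n)) ⟩
      p k (suc n) + (α (suc k) * (F *ₛ p k) n + b * ((z· (G *ₛ F)) *ₛ p k) n)
        -- The factor z is moved past `G`, onto `F *ₛ p k`, where it completes `p (suc k)`.
        ≈⟨ +-congˡ (+-congˡ (*-congˡ (begin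
             ((z· (G *ₛ F)) *ₛ p k) n    ≈⟨ z·-*ₛ (G *ₛ F) (p k) n ⟩
             (z· ((G *ₛ F) *ₛ p k)) n    ≈⟨ z·-cong (*ₛ-assoc G F (p k)) n ⟩
             (z· (G *ₛ (F *ₛ p k))) n    ≈⟨ *ₛ-z· G (F *ₛ p k) n ⟨
             (G *ₛ p (suc k)) n          ∎))) ⟩
      p k (suc n) + (α (suc k) * p (suc k) (suc n) + b * p (suc (suc k)) (suc n)) ∎
      where
      b = β (suc (suc k))
      F = C (suc k)
      G = C (suc (suc k))

    -- The scaling makes the coefficient of `q (suc k)` in `shift (q k)` equal to 1 without any
    -- division by values of `β`.
    q : ℕ → Series
    q k = weight β k ·ₛ p k

    q-shift : ∀ k → ∃ λ w → Span q (suc k) w × shift (q k) ≈ₛ q (suc k) +ₛ w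
    q-shift zero =
      α 0 ·ₛ q 0 +ₛ 0ₛ ,
      span-linear (α 0) (span-basis 0 ℕ.≤-refl) (null (λ _ → refl)) ,
      λ n → begin
        1# * C 0 (suc n)
          ≈⟨ *-congˡ (jFraction-shift {G = C 1} (unfold 0) n) ⟩
        1# * (α 0 * p 0 n + β 1 * p 1 n)
          ≈⟨ solve 4 (λ a x b y → con 1 :* (a :* x :+ b :* y)
                        := b :* con 1 :* y :+ (a :* (con 1 :* x) :+ con 0))
               refl (α 0) (p 0 n) (β 1) (p 1 n) ⟩
        β 1 * 1# * p 1 n + (α 0 * (1# * p 0 n) + 0#) ∎
    q-shift (suc k) =
      α (suc k) ·ₛ q (suc k) +ₛ (β (suc k) ·ₛ q k +ₛ 0ₛ) ,
      span-linear (α (suc k)) (span-basis (suc k) ℕ.≤-refl)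
        (span-linear (β (suc k)) (span-basis k (ℕ.n≤1+n _)) (null (λ _ → refl))) ,
      λ n → begin
        β (suc k) * weight β k * p (suc k) (suc n)
          ≈⟨ *-congˡ (p-shift k n) ⟩
        β (suc k) * weight β k
          * (p k n + (α (suc k) * p (suc k) n + β (suc (suc k)) * p (suc (suc k)) n))
          ≈⟨ solve 7 (λ b W x a y b′ z → b :* W :* (x :+ (a :* y :+ b′ :* z))
                        := b′ :* (b :* W) :* z
                             :+ (a :* (b :* W :* y) :+ (b :* (W :* x) :+ con 0)))
               refl (β (suc k)) (weight β k) (p k n) (α (suc k)) (p (suc k) n)
               (β (suc (suc k))) (p (suc (suc k)) n) ⟩
        q (suc (suc k)) n + (α (suc k) * q (suc k) n + (β (suc k) * q k n + 0#)) ∎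

    hankel-det-tails : ∀ n → det {n} (λ i j → C 0 (toℕ i ℕ.+ toℕ j)) ≈ ∏[ k < n ] weight β (toℕ k)
    hankel-det-tails n = trans
      (hankel-det (C 0) q (λ _ → sym (*-identityˡ _))
        (λ k i i<k → trans (*-congˡ (p-lower k i i<k)) (zeroʳ _)) q-shift n)
      (product-cong {n} λ k → trans (*-congˡ (p-diagonal (toℕ k))) (*-identityʳ _))

  -- Defined by recursion so that `drop (suc k) α` is definitionally `drop k α ∘ suc`, the form in
  -- which `jFraction-unfold` presents the next tail. Only the two leading coefficients then have to
  -- be transported.
  drop : ℕ → (ℕ → Carrier) → ℕ → Carrier
  drop zero    α = α
  drop (suc k) α = drop k α ∘ suc

  drop-lookup : ∀ k α i → drop k α i ≡ α (i ℕ.+ k)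
  drop-lookup zero    α i = ≡.cong α (≡.sym (ℕ.+-identityʳ i))
  drop-lookup (suc k) α i = ≡.trans (drop-lookup k α (suc i)) (≡.cong α (≡.sym (ℕ.+-suc i k)))

  jFraction-hankel-det : ∀ α β n →
    det {n} (λ i j → jFraction α β (toℕ i ℕ.+ toℕ j)) ≈ ∏[ k < n ] weight β (toℕ k)
  jFraction-hankel-det α β = hankel-det-tails α β tails λ k →
    ≡.subst₂ (λ a b → (1- a z- b z² tails (suc k)) *ₛ tails k ≈ₛ 1ₛ)
      (drop-lookup k α 0) (drop-lookup k β 1)
      (jFraction-unfold (drop k α) (drop k β))
    where
    tails : ℕ → Series
    tails k = jFraction (drop k α) (drop k β)

  -- Evaluation of the product of weights

  ∏-powers : ∀ x n → ∏[ i < n ] (x ^ suc (toℕ i)) ≈ x ^ (suc n C 2)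
  ∏-powers x zero    = refl
  ∏-powers x (suc n) = begin
    ∏[ i < suc n ] (x ^ suc (toℕ i))
      ≈⟨ product-init-last {n} (λ i → x ^ suc (toℕ i)) ⟩
    ∏[ i < n ] (x ^ suc (toℕ (inject₁ i))) * x ^ suc (toℕ (fromℕ n))
      ≈⟨ *-cong (product-cong {n} λ i → ^-congʳ x (≡.cong suc (toℕ-inject₁ i)))
                (^-congʳ x (≡.cong suc (toℕ-fromℕ n))) ⟩
    ∏[ i < n ] (x ^ suc (toℕ i)) * x ^ suc n
      ≈⟨ *-congʳ (∏-powers x n) ⟩
    x ^ (suc n C 2) * x ^ suc n
      ≈⟨ *-comm _ _ ⟩
    x ^ suc n * x ^ (suc n C 2)
      ≈⟨ ^-homo-* x (suc n) (suc n C 2) ⟨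
    x ^ (suc n ℕ.+ suc n C 2)
      -- Reading `suc n` as `suc n C 1` makes the exponent an instance of Pascal's rule.
      ≡⟨ ≡.cong (λ m → x ^ (m ℕ.+ suc n C 2)) (nC1≡n (suc n)) ⟨
    x ^ (suc n C 1 ℕ.+ suc n C 2)
      ≡⟨ ≡.cong (x ^_) (nCk+nC[k+1]≡[n+1]C[k+1] (suc n) 1) ⟩
    x ^ (suc (suc n) C 2) ∎

  module _ (a b c d f g h ℓ p r s t u w : Carrier) where
    open Coefficients a b c d f g h ℓ p r s t u w

    weight-factorials : ∀ k → weight β k ≈ (p * r) ^ k * ([ k ]⟨ c , d ⟩! * [ k ]⟨ h , ℓ ⟩!)
    weight-factorials zero    = sym (trans (*-identityˡ _) (*-identityˡ _))
    weight-factorials (suc k) = trans (*-congˡ (weight-factorials k))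
      (solve 6 (λ x y z X A B → x :* y :* z :* (X :* (A :* B)) := x :* X :* (y :* A :* (z :* B)))
         refl (p * r) [ suc k ]⟨ c , d ⟩ [ suc k ]⟨ h , ℓ ⟩ ((p * r) ^ k)
              [ k ]⟨ c , d ⟩! [ k ]⟨ h , ℓ ⟩!)

    hankel-det-𝒞 : ∀ n → det {suc n} (λ i j → 𝒞 (toℕ i ℕ.+ toℕ j))
      ≈ (p * r) ^ (suc n C 2)
        * ∏[ i < n ] ([ suc (toℕ i) ]⟨ c , d ⟩! * [ suc (toℕ i) ]⟨ h , ℓ ⟩!)
    hankel-det-𝒞 n = begin
      det {suc n} (λ i j → 𝒞 (toℕ i ℕ.+ toℕ j))
        ≈⟨ jFraction-hankel-det α β (suc n) ⟩
      -- The factor of index 0 is `weight β 0`, which is `1#`; the remaining `n` factors have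
      -- indices 1 to `n`.
      1# * ∏[ i < n ] weight β (suc (toℕ i))
        ≈⟨ *-identityˡ _ ⟩
      ∏[ i < n ] weight β (suc (toℕ i))
        ≈⟨ product-cong {n} (λ i → weight-factorials (suc (toℕ i))) ⟩
      ∏[ i < n ] ((p * r) ^ suc (toℕ i) * factorials i)
        ≈⟨ ∏-distrib-* {n} (λ i → (p * r) ^ suc (toℕ i)) factorials ⟩
      ∏[ i < n ] ((p * r) ^ suc (toℕ i)) * ∏[ i < n ] factorials i
        ≈⟨ *-congʳ (∏-powers (p * r) n) ⟩
      (p * r) ^ (suc n C 2) * ∏[ i < n ] factorials i ∎
      where
      factorials : Fin n → Carrier
      factorials i = [ suc (toℕ i) ]⟨ c , d ⟩! * [ suc (toℕ i) ]⟨ h , ℓ ⟩!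

corollary2 : ∀ {κ κ′} (R : CommutativeRing κ κ′) →
    let open CommutativeRing R
        open JFractions R in
    (a b c d f g h ℓ p r s t u w : Carrier) →
    let open Coefficients a b c d f g h ℓ p r s t u w
        m = 𝒞 in
    (n : ℕ) →
    det {suc n} (λ i j → m (toℕ i ℕ.+ toℕ j))
      ≈ (p * r) ^ (suc n C 2)
        * ∏[ i < n ] ([ suc (toℕ i) ]⟨ c , d ⟩! * [ suc (toℕ i) ]⟨ h , ℓ ⟩!)
corollary2 R = HankelDeterminants.hankel-det-𝒞 R
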